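{- Let $n\ge 1$, $m\ge 1$, and let $(a)^j=(a^j_1,\dots,a^j_n)$ and $(b)^j=(b^j_1,\dots,b^j_m)$ be monotonically non-increasing sequences of non-negative integers, the sequences present at the start of iteration $j$ of the construction algorithm. If $(a)^j,(b)^j$ are realisable by a hypergraph with $m$ edges and $n$ vertices, then the sequences $(a)^{j+1},(b)^{j+1}$ constructed at iteration $j$ are realisable by a hypergraph with $m-1$ edges and $n$ vertices.
   Context: A hypergraph $H=(V,E)$ consists of a finite vertex set $V=\{v_1,\dots,v_n\}$ and a finite multiset $E=\{e_1,\dots,e_m\}$ of edges, each edge being a subset of $V$. Parallel (repeated) edges are allowed. There are no self-loops: a vertex occurs at most once in an edge. Vertices of degree $0$ are allowed, and the hypergraph with $n$ vertices and $E=\emptyset$ is a hypergraph with $0$ edges. The degree of a vertex is the number of edges (counted with multiplicity) containing it, and the dimension of an edge is its cardinality. A pair consisting of an integer sequence $(a_1,\dots,a_n)$ and an integer sequence $(b_1,\dots,b_m)$ is realisable by a hypergraph with $m$ edges and $n$ vertices if there is a hypergraph with $n$ vertices whose degrees are $a_1,\dots,a_n$ and with $m$ edges whose dimensions are $b_1,\dots,b_m$. Construction algorithm. The input is a degree sequence and a dimension sequence, both sorted in non-increasing order; these are the initial $(a)^1$ and $(b)^1$. Both sequences are non-increasing at the start of each iteration. Iteration $j$, starting from $(a)^j=(a^j_1,\dots,a^j_n)$ and $(b)^j=(b^j_1,\dots,b^j_m)$ (here $m$ denotes the number of edges still to be constructed at the start of iteration $j$), does the following: 1. It constructs the edge $e_j$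 consisting of the $b^j_1$ vertices corresponding to the first $b^j_1$ components of $(a)^j$ (the vertices with the largest remaining degrees). 2. It lets $(a)^{j+1}$ be the sequence obtained from $(a)^j$ by reducing its first $b^j_1$ components by $1$ and then sorting the result in non-increasing order. 3. It lets $(b)^{j+1}=(b^j_2,\dots,b^j_m)$. -}

module Defs where

open import Data.Bool.Base using (if_then_else_)
open import Data.Fin.Base using (Fin; toℕ)
open import Data.Fin.Subset using (Subset; ∣_∣)
open import Data.Fin.Subset.Properties using (_∈?_)
open import Data.Integer.Base as ℤ using (ℤ; +_; _≥_)
open import Data.Integer.Properties using (≤-decTotalOrder; _<?_)
open import Data.List.Relation.Binary.Permutation.Propositional.Properties using (↭-length)
import Data.List.Sort
open import Data.Nat.Base using (ℕ; suc)
open import Data.Product.Base using (Σ-syntax; _×_)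
open import Data.Vec.Base using (Vec; cast; count; fromList; head; lookup; tabulate; tail; toList; zipWith)
open import Data.Vec.Properties using (length-toList)
open import Data.Vec.Relation.Unary.Linked using (Linked)
open import Relation.Binary.PropositionalEquality.Core using (_≡_; trans)
open import Relation.Binary.Properties.DecTotalOrder ≤-decTotalOrder using (≥-decTotalOrder)
open import Relation.Nullary.Decidable.Core using (does)

open Data.List.Sort ≥-decTotalOrder using (sort; sort-↭)

-- The vertices are the elements of Fin n.  The multiset of edges is given by
-- an enumeration, so an edge may be repeated (and may be empty).
Hypergraph : ℕ → ℕ → Set
Hypergraph n m = Vec (Subset n) m

degree : ∀ {n m} → Hypergraph n m → Fin n → ℕ
degree H v = count (v ∈?_) H

dimension : ∀ {n m} → Hypergraph n m → Fin m → ℕ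
dimension H e = ∣ lookup H e ∣

-- The numbers of vertices and edges are the lengths of the two sequences.
Realisable : ∀ {n m} → Vec ℤ n → Vec ℤ m → Set
Realisable {n} {m} a b =
  Σ[ H ∈ Hypergraph n m ]
    (∀ v → + degree H v ≡ lookup a v) × (∀ e → + dimension H e ≡ lookup b e)

NonIncreasing : ∀ {n} → Vec ℤ n → Set
NonIncreasing = Linked _≥_

sortNonIncreasing : ∀ {n} → Vec ℤ n → Vec ℤ n
sortNonIncreasing a =
  cast (trans (↭-length (sort-↭ (toList a))) (length-toList a)) (fromList (sort (toList a)))

-- The set of the first k positions; all n positions if k exceeds n, and none
-- if k is negative.
firstPositions : ∀ n → ℤ → Subset n
firstPositions n k = tabulate λ i → does (+ toℕ i <? k)

-- The edge built in one iteration, as a set of positions in the current degree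
-- sequence.
nextEdge : ∀ {n m} → Vec ℤ n → Vec ℤ (suc m) → Subset n
nextEdge {n} a b = firstPositions n (head b)

reduceOn : ∀ {n} → Subset n → Vec ℤ n → Vec ℤ n
reduceOn = zipWith λ s x → if s then ℤ.pred x else x

nextDegrees : ∀ {n m} → Vec ℤ n → Vec ℤ (suc m) → Vec ℤ n
nextDegrees a b = sortNonIncreasing (reduceOn (nextEdge a b) a)

nextDimensions : ∀ {m} → Vec ℤ (suc m) → Vec ℤ m
nextDimensions = tail

{-# OPTIONS --safe #-}
-- Let e be the first edge of a realisation, G the remaining edges, and F the
-- set of the first ∣ e ∣ positions.  If e ≠ F, choose i ∈ F ∖ e and j ∈ e ∖ F.
-- Since i comes before j, its degree in e ∷ G is at least that of j, so in G
-- the degree of i exceeds that of j, and some edge of G contains i but not j.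
-- Exchanging i and j between that edge and e changes neither degrees nor
-- dimensions and brings e closer to F.  Once e = F, deleting it leaves the
-- reduced degree sequence, and sorting only renames the vertices.
module Submission where

open import Defs
import Algebra.Properties.CommutativeMonoid.Sum
import Algebra.Properties.CommutativeSemigroup
open import Data.Bool.Base using (if_then_else_)
open import Data.Fin.Base as Fin using (Fin; zero; suc; toℕ)
open import Data.Fin.Permutation using (Permutation; _⟨$⟩ʳ_; _∘ₚ_; cast-id)
open import Data.Fin.Subset using (Subset; inside; outside; ⁅_⁆; _∈_; _∉_; _⊆_; _⊂_; _∩_; ∁; ∣_∣; Nonempty)
open import Data.Fin.Subset.Properties using (_∈?_; nonempty?; ⊆-antisym; p⊂q⇒∣p∣<∣q∣; ∣p∣≤n; x∈p∩q⁺; x∈p∩q⁻; x∈∁p⇒x∉p; x∉p⇒x∈∁p)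
open import Data.Integer.Base as ℤ using (ℤ; +_; 0ℤ; _≤_)
open import Data.Integer.Properties as ℤ using (_<?_)
open import Data.List.Base as List using (List)
import Data.List.Relation.Binary.Permutation.Homogeneous as Homogeneous
open import Data.List.Relation.Binary.Permutation.Propositional using (_↭_; ↭⇒↭ₛ)
open import Data.List.Relation.Binary.Permutation.Propositional.Properties using (↭-length)
import Data.List.Relation.Binary.Permutation.Setoid.Properties as Permutationₛ
import Data.List.Sort
open import Data.Nat.Base as ℕ using (ℕ; zero; suc; _+_; _≥_; _<_; s≤s)
open import Data.Nat.Induction using (<-wellFounded)
open import Data.Nat.Properties as ℕ using (+-0-commutativeMonoid; +-commutativeSemigroup)
open import Data.Product.Base using (Σ-syntax; _×_; _,_; proj₁; proj₂)
open import Data.Vec.Base using (Vec; []; _∷_; _[_]≔_; here; there; cast; fromList; lookup; map; tabulate; toList)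
open import Data.Vec.Properties using ([]=⇒lookup; lookup⇒[]=; []≔-idempotent; []≔-lookup; []≔-updates; []≔-minimal; []=-injective; lookup-cast₁; lookup-map; lookup-replicate; lookup-zipWith; lookup∘tabulate; length-toList)
open import Data.Vec.Relation.Unary.All using (All)
open import Data.Vec.Relation.Unary.Linked.Properties using (lookup⁺)
open import Function.Base using (_∘_; case_of_)
open import Induction.WellFounded using (Acc; acc)
open import Relation.Binary.Properties.DecTotalOrder ℤ.≤-decTotalOrder using (≥-decTotalOrder)
open import Relation.Binary.PropositionalEquality using (_≡_; _≢_; refl; sym; trans; cong; cong₂; subst; subst₂; setoid; module ≡-Reasoning)
open import Relation.Nullary using (¬_; Dec; yes; no; does; contradiction)
open import Relation.Nullary.Decidable using (dec-true)

open Algebra.Properties.CommutativeMonoid.Sum +-0-commutativeMonoid using (sum; sum-cong-≗; sum-permute)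
open Algebra.Properties.CommutativeSemigroup +-commutativeSemigroup using (interchange; xy∙z≈xz∙y)
open Data.List.Sort ≥-decTotalOrder using (sort; sort-↭)

private
  variable
    n n′ m : ℕ

-- Incidence functions, degrees and cardinalities.

incidence : Subset n → Fin n → ℕ
incidence p v = if lookup p v then 1 else 0

-- `degree` counts through the decision `v ∈? p`, while `incidence` reads the stored side; this
-- equation lets one case split drive both.
does-∈? : ∀ (v : Fin n) p → does (v ∈? p) ≡ lookup p v
does-∈? zero    (inside  ∷ p) = refl
does-∈? zero    (outside ∷ p) = refl
does-∈? (suc v) (s       ∷ p) = does-∈? v p

degree-∷ : ∀ e (H : Hypergraph n m) v → degree (e ∷ H) v ≡ incidence e v + degree H v
degree-∷ e H v rewrite does-∈? v e with lookup e v
... | inside  = refl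
... | outside = refl

-- Puts cardinality in the form of a finite sum, which can be reindexed along a permutation.
∣p∣≡sum-incidence : (p : Subset n) → ∣ p ∣ ≡ sum (incidence p)
∣p∣≡sum-incidence []            = refl
∣p∣≡sum-incidence (inside  ∷ p) = cong suc (∣p∣≡sum-incidence p)
∣p∣≡sum-incidence (outside ∷ p) = ∣p∣≡sum-incidence p

∈⇒incidence≡1 : ∀ {p : Subset n} {v} → v ∈ p → incidence p v ≡ 1
∈⇒incidence≡1 v∈p rewrite []=⇒lookup v∈p = refl

∉⇒incidence≡0 : ∀ {p : Subset n} {v} → v ∉ p → incidence p v ≡ 0
∉⇒incidence≡0 {p = p} {v} v∉p with lookup p v in eq
... | inside  = contradiction (lookup⇒[]= v p eq) v∉p
... | outside = refl

incidence-insert : ∀ {p : Subset n} {i} → i ∉ p → ∀ v →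
                   incidence (p [ i ]≔ inside) v ≡ incidence p v + incidence ⁅ i ⁆ v
incidence-insert {p = inside  ∷ p} {zero}  i∉p _       = contradiction here i∉p
incidence-insert {p = outside ∷ p} {zero}  i∉p zero    = refl
incidence-insert {p = outside ∷ p} {zero}  i∉p (suc v)
  rewrite lookup-replicate v outside = sym (ℕ.+-identityʳ _)
incidence-insert {p = s       ∷ p} {suc i} i∉p zero    = sym (ℕ.+-identityʳ _)
incidence-insert {p = s       ∷ p} {suc i} i∉p (suc v) = incidence-insert (i∉p ∘ there) v

∣insert∣ : ∀ {p : Subset n} {i} → i ∉ p → ∣ p [ i ]≔ inside ∣ ≡ suc ∣ p ∣
∣insert∣ {p = inside  ∷ p} {zero}  i∉p = contradiction here i∉p
∣insert∣ {p = outside ∷ p} {zero}  i∉p = refl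
∣insert∣ {p = inside  ∷ p} {suc i} i∉p = cong suc (∣insert∣ (i∉p ∘ there))
∣insert∣ {p = outside ∷ p} {suc i} i∉p = ∣insert∣ (i∉p ∘ there)

-- Exchanging two vertices in one edge.

exchange : Fin n → Fin n → Subset n → Subset n
exchange i j p = (p [ i ]≔ inside) [ j ]≔ outside

module _ {p : Subset n} {i j : Fin n} (i∉p : i ∉ p) (j∈p : j ∈ p) where

  private
    i≢j : i ≢ j
    i≢j refl = i∉p j∈p

    j∉exchange : j ∉ exchange i j p
    j∉exchange j∈ = case []=-injective j∈ ([]≔-updates (p [ i ]≔ inside) j) of λ ()

    exchange-insert : exchange i j p [ j ]≔ inside ≡ p [ i ]≔ inside
    exchange-insert = begin
      exchange i j p [ j ]≔ inside                    ≡⟨ []≔-idempotent p′ j ⟩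
      -- Since `i ≢ j`, the vertex `j` is still in `p′`, so writing `inside` there changes nothing.
      p′ [ j ]≔ inside                                ≡⟨ cong (p′ [ j ]≔_) ([]=⇒lookup ([]≔-minimal p j i (i≢j ∘ sym) j∈p)) ⟨
      p′ [ j ]≔ lookup p′ j                           ≡⟨ []≔-lookup p′ j ⟩
      p′                                              ∎
      where
      open ≡-Reasoning
      p′ = p [ i ]≔ inside

  -- Both sides are the incidence function of `p [ i ]≔ inside`, reached from `exchange i j p` by
  -- putting `j` back and from `p` by adding `i`. Keeping the removed vertex as a summand on the
  -- left avoids truncated subtraction.
  incidence-exchange : ∀ v → incidence (exchange i j p) v + incidence ⁅ j ⁆ v ≡
                             incidence p v + incidence ⁅ i ⁆ v
  incidence-exchange v = begin
    incidence (exchange i j p) v + incidence ⁅ j ⁆ v  ≡⟨ incidence-insert j∉exchange v ⟨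
    incidence (exchange i j p [ j ]≔ inside) v        ≡⟨ cong (λ q → incidence q v) exchange-insert ⟩
    incidence (p [ i ]≔ inside) v                     ≡⟨ incidence-insert i∉p v ⟩
    incidence p v + incidence ⁅ i ⁆ v                 ∎
    where open ≡-Reasoning

  ∣exchange∣ : ∣ exchange i j p ∣ ≡ ∣ p ∣
  ∣exchange∣ = ℕ.suc-injective (begin
    suc ∣ exchange i j p ∣            ≡⟨ ∣insert∣ j∉exchange ⟨
    ∣ exchange i j p [ j ]≔ inside ∣  ≡⟨ cong ∣_∣ exchange-insert ⟩
    ∣ p [ i ]≔ inside ∣               ≡⟨ ∣insert∣ i∉p ⟩
    suc ∣ p ∣                         ∎)
    where open ≡-Reasoning

  -- The exchange takes `i` out of the difference, and losing `j` adds nothing to it because `j` is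
  -- outside `F`. This drives the termination of `realign`.
  exchange-closer : ∀ {F} → i ∈ F → j ∉ F → F ∩ ∁ (exchange i j p) ⊂ F ∩ ∁ p
  exchange-closer {F} i∈F j∉F = sub , i , x∈p∩q⁺ (i∈F , x∉p⇒x∈∁p i∉p) , i∉
    where
    i∈exchange : i ∈ exchange i j p
    i∈exchange = []≔-minimal _ i j i≢j ([]≔-updates p i)

    i∉ : i ∉ F ∩ ∁ (exchange i j p)
    i∉ i∈ = x∈∁p⇒x∉p (proj₂ (x∈p∩q⁻ F _ i∈)) i∈exchange

    sub : ∀ {x} → x ∈ F ∩ ∁ (exchange i j p) → x ∈ F ∩ ∁ p
    sub {x} x∈ with x∈p∩q⁻ F _ x∈
    ... | x∈F , x∈∁ = x∈p∩q⁺ (x∈F , x∉p⇒x∈∁p x∉p)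
      where
      x≢j : x ≢ j
      x≢j refl = j∉F x∈F

      x≢i : x ≢ i
      x≢i refl = x∈∁p⇒x∉p x∈∁ i∈exchange

      x∉p : x ∉ p
      x∉p x∈p = x∈∁p⇒x∉p x∈∁ ([]≔-minimal _ x j x≢j ([]≔-minimal p x i x≢i x∈p))

-- Moving one unit of degree from one vertex to another.

SameDimensions : Hypergraph n m → Hypergraph n m → Set
SameDimensions H H′ = ∀ k → dimension H k ≡ dimension H′ k

-- Search for the first edge containing `i` but not `j` and exchange there. Every edge passed over
-- contributes at least as much to `j` as to `i`, so the strict inequality survives its removal; it
-- fails for the empty hypergraph, where all degrees are 0, so the search succeeds.
lower-degree : ∀ (G : Hypergraph n m) {i j} → degree G j < degree G i →
  Σ[ G′ ∈ Hypergraph n m ]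
    (∀ v → degree G′ v + incidence ⁅ i ⁆ v ≡ degree G v + incidence ⁅ j ⁆ v) × SameDimensions G′ G
lower-degree {n = n} (f ∷ G) {i} {j} dⱼ<dᵢ = choose (i ∈? f) (j ∈? f)
  where
  Lowered = Σ[ G′ ∈ Hypergraph n _ ]
    (∀ v → degree G′ v + incidence ⁅ i ⁆ v ≡ degree (f ∷ G) v + incidence ⁅ j ⁆ v) ×
    SameDimensions G′ (f ∷ G)

  here-lowered : j ∉ f → i ∈ f → Lowered
  here-lowered j∉f i∈f = exchange j i f ∷ G , degrees , λ { zero → ∣exchange∣ j∉f i∈f ; (suc k) → refl }
    where
    degrees : ∀ v → degree (exchange j i f ∷ G) v + incidence ⁅ i ⁆ v ≡
                    degree (f ∷ G) v + incidence ⁅ j ⁆ v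
    degrees v = begin
      degree (exchange j i f ∷ G) v + incidence ⁅ i ⁆ v              ≡⟨ cong (_+ _) (degree-∷ (exchange j i f) G v) ⟩
      incidence (exchange j i f) v + degree G v + incidence ⁅ i ⁆ v  ≡⟨ xy∙z≈xz∙y (incidence (exchange j i f) v) _ _ ⟩
      incidence (exchange j i f) v + incidence ⁅ i ⁆ v + degree G v  ≡⟨ cong (ℕ._+ degree G v) (incidence-exchange j∉f i∈f v) ⟩
      incidence f v + incidence ⁅ j ⁆ v + degree G v                 ≡⟨ xy∙z≈xz∙y (incidence f v) _ _ ⟩
      incidence f v + degree G v + incidence ⁅ j ⁆ v                 ≡⟨ cong (_+ _) (degree-∷ f G v) ⟨
      degree (f ∷ G) v + incidence ⁅ j ⁆ v                           ∎
      where open ≡-Reasoning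

  there-lowered : incidence f i ℕ.≤ incidence f j → Lowered
  there-lowered fᵢ≤fⱼ = f ∷ G′ , degrees′ , λ { zero → refl ; (suc k) → dims k }
    where
    gap : degree G j < degree G i
    gap = ℕ.+-cancelˡ-< (incidence f j) _ _ (begin-strict
      incidence f j + degree G j  ≡⟨ degree-∷ f G j ⟨
      degree (f ∷ G) j            <⟨ dⱼ<dᵢ ⟩
      degree (f ∷ G) i            ≡⟨ degree-∷ f G i ⟩
      incidence f i + degree G i  ≤⟨ ℕ.+-monoˡ-≤ _ fᵢ≤fⱼ ⟩
      incidence f j + degree G i  ∎)
      where open ℕ.≤-Reasoning

    lowered = lower-degree G gap
    G′      = proj₁ lowered
    degrees = proj₁ (proj₂ lowered)
    dims    = proj₂ (proj₂ lowered)

    degrees′ : ∀ v → degree (f ∷ G′) v + incidence ⁅ i ⁆ v ≡ degree (f ∷ G) v + incidence ⁅ j ⁆ v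
    degrees′ v = begin
      degree (f ∷ G′) v + incidence ⁅ i ⁆ v               ≡⟨ cong (_+ _) (degree-∷ f G′ v) ⟩
      incidence f v + degree G′ v + incidence ⁅ i ⁆ v     ≡⟨ ℕ.+-assoc (incidence f v) _ _ ⟩
      incidence f v + (degree G′ v + incidence ⁅ i ⁆ v)   ≡⟨ cong (incidence f v ℕ.+_) (degrees v) ⟩
      incidence f v + (degree G v + incidence ⁅ j ⁆ v)    ≡⟨ ℕ.+-assoc (incidence f v) _ _ ⟨
      incidence f v + degree G v + incidence ⁅ j ⁆ v      ≡⟨ cong (_+ _) (degree-∷ f G v) ⟨
      degree (f ∷ G) v + incidence ⁅ j ⁆ v                ∎
      where open ≡-Reasoning

  choose : Dec (i ∈ f) → Dec (j ∈ f) → Lowered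
  choose (yes i∈f) (no j∉f)  = here-lowered j∉f i∈f
  choose (yes i∈f) (yes j∈f) = there-lowered (ℕ.≤-reflexive (trans (∈⇒incidence≡1 i∈f) (sym (∈⇒incidence≡1 j∈f))))
  choose (no i∉f)  _         = there-lowered (subst (ℕ._≤ _) (sym (∉⇒incidence≡0 i∉f)) ℕ.z≤n)

-- Turning the first edge into a prescribed set.

empty-difference⇒⊆ : ∀ {p q : Subset n} → ¬ Nonempty (p ∩ ∁ q) → p ⊆ q
empty-difference⇒⊆ {q = q} empty {x} x∈p with x ∈? q
... | yes x∈q = x∈q
... | no  x∉q = contradiction (x , x∈p∩q⁺ (x∈p , x∉p⇒x∈∁p x∉q)) empty

difference⇒⊂ : ∀ {p q : Subset n} → p ⊆ q → Nonempty (q ∩ ∁ p) → p ⊂ q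
difference⇒⊂ {q = q} p⊆q (x , x∈) with x∈p∩q⁻ q _ x∈
... | x∈q , x∈∁p = p⊆q , x , x∈q , x∈∁p⇒x∉p x∈∁p

-- Well-founded recursion on the number of elements of `F` missing from `e`. The degree hypothesis
-- concerns `e ∷ G` as a whole, so it is inherited by the exchanged hypergraph, whose degrees are
-- the same.
realign : ∀ F {e} {G : Hypergraph n m} → ∣ e ∣ ≡ ∣ F ∣ →
  (∀ {i j} → i ∈ F → j ∉ F → degree (e ∷ G) j ℕ.≤ degree (e ∷ G) i) →
  Acc _<_ ∣ F ∩ ∁ e ∣ →
  Σ[ G′ ∈ Hypergraph n m ]
    (∀ v → degree (F ∷ G′) v ≡ degree (e ∷ G) v) × SameDimensions G′ G
realign F {e} {G} ∣e∣≡∣F∣ F-largest (acc rec) with nonempty? (F ∩ ∁ e) | nonempty? (e ∩ ∁ F)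
... | no F⊈e | no e⊈F =
  G , (λ v → cong (λ p → degree (p ∷ G) v) (⊆-antisym (empty-difference⇒⊆ F⊈e) (empty-difference⇒⊆ e⊈F))) , λ k → refl
-- If only one of the two differences is empty, one set is strictly contained in the other, against
-- the equal cardinalities.
... | no F⊈e | yes ne =
  contradiction (sym ∣e∣≡∣F∣) (ℕ.<⇒≢ (p⊂q⇒∣p∣<∣q∣ (difference⇒⊂ (empty-difference⇒⊆ F⊈e) ne)))
... | yes ne | no e⊈F =
  contradiction ∣e∣≡∣F∣ (ℕ.<⇒≢ (p⊂q⇒∣p∣<∣q∣ (difference⇒⊂ (empty-difference⇒⊆ e⊈F) ne)))
... | yes (i , i∈) | yes (j , j∈) =
  let i∈F , i∈∁e = x∈p∩q⁻ F _ i∈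
      j∈e , j∈∁F = x∈p∩q⁻ e _ j∈
  in step i∈F (x∈∁p⇒x∉p i∈∁e) j∈e (x∈∁p⇒x∉p j∈∁F)
  where
  step : i ∈ F → i ∉ e → j ∈ e → j ∉ F → _
  step i∈F i∉e j∈e j∉F = G₂ , (λ v → trans (degrees₂ v) (same v)) , λ k → trans (dims₂ k) (dims₁ k)
    where
    gap : degree G j < degree G i
    gap = begin
      suc (degree G j)            ≡⟨ cong (ℕ._+ degree G j) (∈⇒incidence≡1 j∈e) ⟨
      incidence e j + degree G j  ≡⟨ degree-∷ e G j ⟨
      degree (e ∷ G) j            ≤⟨ F-largest i∈F j∉F ⟩
      degree (e ∷ G) i            ≡⟨ degree-∷ e G i ⟩
      incidence e i + degree G i  ≡⟨ cong (ℕ._+ degree G i) (∉⇒incidence≡0 i∉e) ⟩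
      degree G i                  ∎
      where open ℕ.≤-Reasoning

    lowered  = lower-degree G gap
    G₁       = proj₁ lowered
    degrees₁ = proj₁ (proj₂ lowered)
    dims₁    = proj₂ (proj₂ lowered)

    same : ∀ v → degree (exchange i j e ∷ G₁) v ≡ degree (e ∷ G) v
    -- The first edge trades `j` for `i` and the remaining edges trade `i` for `j`. With both
    -- indicators added to each side, the two trades become additive equations and the indicators
    -- cancel.
    same v = ℕ.+-cancelʳ-≡ (incidence ⁅ j ⁆ v + incidence ⁅ i ⁆ v) _ _ (begin
      degree (exchange i j e ∷ G₁) v + (incidence ⁅ j ⁆ v + incidence ⁅ i ⁆ v)
        ≡⟨ cong (_+ _) (degree-∷ (exchange i j e) G₁ v) ⟩
      incidence (exchange i j e) v + degree G₁ v + (incidence ⁅ j ⁆ v + incidence ⁅ i ⁆ v)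
        ≡⟨ interchange (incidence (exchange i j e) v) _ _ _ ⟩
      incidence (exchange i j e) v + incidence ⁅ j ⁆ v + (degree G₁ v + incidence ⁅ i ⁆ v)
        ≡⟨ cong₂ _+_ (incidence-exchange i∉e j∈e v) (degrees₁ v) ⟩
      incidence e v + incidence ⁅ i ⁆ v + (degree G v + incidence ⁅ j ⁆ v)
        ≡⟨ interchange (incidence e v) _ _ _ ⟩
      incidence e v + degree G v + (incidence ⁅ i ⁆ v + incidence ⁅ j ⁆ v)
        ≡⟨ cong₂ _+_ (sym (degree-∷ e G v)) (ℕ.+-comm (incidence ⁅ i ⁆ v) _) ⟩
      degree (e ∷ G) v + (incidence ⁅ j ⁆ v + incidence ⁅ i ⁆ v)
        ∎)
      where open ≡-Reasoning

    realigned = realign F {exchange i j e} {G₁}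
      (trans (∣exchange∣ i∉e j∈e) ∣e∣≡∣F∣)
      (λ {k} {l} k∈F l∉F → subst₂ ℕ._≤_ (sym (same l)) (sym (same k)) (F-largest k∈F l∉F))
      (rec (p⊂q⇒∣p∣<∣q∣ (exchange-closer i∉e j∈e i∈F j∉F)))
    G₂       = proj₁ realigned
    degrees₂ = proj₁ (proj₂ realigned)
    dims₂    = proj₂ (proj₂ realigned)

-- The set of first positions.

-- The Boolean of the comparison computes through a successor on both sides, so each inductive step
-- is definitional. The bound `k ≤ n` excludes the case where the set is cut off at `n`.
∣firstPositions∣ : ∀ {k} → k ℕ.≤ n → ∣ firstPositions n (+ k) ∣ ≡ k
∣firstPositions∣ {zero}  ℕ.z≤n     = refl
∣firstPositions∣ {suc n} ℕ.z≤n     = ∣firstPositions∣ {n} ℕ.z≤n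
∣firstPositions∣ {suc n} (s≤s k≤n) = cong suc (∣firstPositions∣ k≤n)

lookup-firstPositions : ∀ k (v : Fin n) → lookup (firstPositions n k) v ≡ does (+ toℕ v <? k)
lookup-firstPositions k = lookup∘tabulate (λ v → does (+ toℕ v <? k))

∈firstPositions⇒< : ∀ {k} {v : Fin n} → v ∈ firstPositions n k → + toℕ v ℤ.< k
∈firstPositions⇒< {k = k} {v} v∈ with + toℕ v <? k | trans (sym (lookup-firstPositions k v)) ([]=⇒lookup v∈)
... | yes v<k | _  = v<k
... | no  _   | ()

<⇒∈firstPositions : ∀ {k} {v : Fin n} → + toℕ v ℤ.< k → v ∈ firstPositions n k
<⇒∈firstPositions {n} {k} {v} v<k =
  lookup⇒[]= v _ (trans (lookup-firstPositions k v) (dec-true (+ toℕ v <? k) v<k))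

-- Renaming vertices and sorting.

-- The preimage of `p`: the permutation leads from new names to old ones, so degrees after renaming
-- are the old degrees composed with `π`.
rename : Permutation n′ n → Subset n → Subset n′
rename π p = tabulate (lookup p ∘ (π ⟨$⟩ʳ_))

incidence-rename : ∀ (π : Permutation n′ n) p v → incidence (rename π p) v ≡ incidence p (π ⟨$⟩ʳ v)
incidence-rename π p v = cong (if_then 1 else 0) (lookup∘tabulate (lookup p ∘ (π ⟨$⟩ʳ_)) v)

∣rename∣ : ∀ (π : Permutation n′ n) p → ∣ rename π p ∣ ≡ ∣ p ∣
∣rename∣ π p = begin
  ∣ rename π p ∣                      ≡⟨ ∣p∣≡sum-incidence (rename π p) ⟩
  sum (incidence (rename π p))        ≡⟨ sum-cong-≗ (incidence-rename π p) ⟩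
  sum (incidence p ∘ (π ⟨$⟩ʳ_))       ≡⟨ sum-permute (incidence p) π ⟨
  sum (incidence p)                   ≡⟨ ∣p∣≡sum-incidence p ⟨
  ∣ p ∣                               ∎
  where open ≡-Reasoning

degree-rename : ∀ (π : Permutation n′ n) (H : Hypergraph n m) v →
                degree (map (rename π) H) v ≡ degree H (π ⟨$⟩ʳ v)
degree-rename π []      v = refl
degree-rename π (e ∷ H) v = begin
  degree (rename π e ∷ map (rename π) H) v                   ≡⟨ degree-∷ (rename π e) (map (rename π) H) v ⟩
  incidence (rename π e) v + degree (map (rename π) H) v     ≡⟨ cong₂ _+_ (incidence-rename π e v) (degree-rename π H v) ⟩
  incidence e (π ⟨$⟩ʳ v) + degree H (π ⟨$⟩ʳ v)               ≡⟨ degree-∷ e H (π ⟨$⟩ʳ v) ⟨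
  degree (e ∷ H) (π ⟨$⟩ʳ v)                                  ∎
  where open ≡-Reasoning

realisable-rename : ∀ (a : Vec ℤ n) (a′ : Vec ℤ n′) (b : Vec ℤ m) (π : Permutation n′ n) →
                    (∀ v → lookup a′ v ≡ lookup a (π ⟨$⟩ʳ v)) → Realisable a b → Realisable a′ b
realisable-rename a a′ b π a′≗a∘π (H , degrees , dims) =
  map (rename π) H ,
  (λ v → trans (cong +_ (degree-rename π H v)) (trans (degrees (π ⟨$⟩ʳ v)) (sym (a′≗a∘π v)))) ,
  λ k → trans (cong +_ (trans (cong ∣_∣ (lookup-map k (rename π) H)) (∣rename∣ π (lookup H k)))) (dims k)

module _ {A : Set} where

  lookup-fromList : ∀ (xs : List A) i → lookup (fromList xs) i ≡ List.lookup xs i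
  lookup-fromList (x List.∷ xs) zero    = refl
  lookup-fromList (x List.∷ xs) (suc i) = lookup-fromList xs i

  lookup-toList : ∀ (a : Vec A n) i → List.lookup (toList a) i ≡ lookup a (Fin.cast (length-toList a) i)
  lookup-toList (x ∷ a) zero    = refl
  lookup-toList (x ∷ a) (suc i) = lookup-toList a i

-- A permutation of lists induces a bijection `σ` of their indices, and renaming along it suffices.
-- The casts on either side of `σ` are needed because the list lengths equal `n` only
-- propositionally.
realisable-↭ : ∀ xs (a : Vec ℤ n) (b : Vec ℤ m) (eq : List.length xs ≡ n) →
               xs ↭ toList a → Realisable a b → Realisable (cast eq (fromList xs)) b
realisable-↭ xs a b eq xs↭a =
  realisable-rename a (cast eq (fromList xs)) b (cast-id (sym eq) ∘ₚ σ ∘ₚ cast-id (length-toList a)) λ v → begin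
    lookup (cast eq (fromList xs)) v                                    ≡⟨ lookup-cast₁ eq (fromList xs) v ⟩
    lookup (fromList xs) (Fin.cast (sym eq) v)                          ≡⟨ lookup-fromList xs _ ⟩
    List.lookup xs (Fin.cast (sym eq) v)                                ≡⟨ Permutationₛ.onIndices-lookup (setoid ℤ) (↭⇒↭ₛ xs↭a) _ ⟩
    List.lookup (toList a) (σ ⟨$⟩ʳ Fin.cast (sym eq) v)                 ≡⟨ lookup-toList a _ ⟩
    lookup a (Fin.cast (length-toList a) (σ ⟨$⟩ʳ Fin.cast (sym eq) v))  ∎
  where
  open ≡-Reasoning
  σ = Homogeneous.onIndices (↭⇒↭ₛ xs↭a)

realisable-sort : ∀ (a : Vec ℤ n) (b : Vec ℤ m) → Realisable a b → Realisable (sortNonIncreasing a) b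
realisable-sort a b =
  realisable-↭ (sort (toList a)) a b (trans (↭-length a↭) (length-toList a)) a↭
  where a↭ = sort-↭ (toList a)

-- One iteration of the construction.

NonIncreasing⇒lookup-mono : ∀ {a : Vec ℤ n} → NonIncreasing a →
                            ∀ {i j} → i Fin.< j → lookup a j ≤ lookup a i
NonIncreasing⇒lookup-mono a↘ = lookup⁺ (λ x≥y y≥z → ℤ.≤-trans y≥z x≥y) a↘

-- Deleting the edge `p` from a realisation leaves the degree `d` at `v`. Where `v` lies in `p`, the
-- entry is `+ suc d`, whose predecessor computes to `+ d`.
lookup-reduceOn : ∀ p (a : Vec ℤ n) {d} v → + (incidence p v + d) ≡ lookup a v →
                  + d ≡ lookup (reduceOn p a) v
lookup-reduceOn p a v eq rewrite lookup-zipWith (λ s x → if s then ℤ.pred x else x) v p a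
  with lookup p v
... | inside  = cong ℤ.pred eq
... | outside = eq

theorem2 : ∀ (n m : ℕ) → n ≥ 1 →
    (a : Vec ℤ n) (b : Vec ℤ (suc m)) →
    NonIncreasing a → NonIncreasing b →
    All (0ℤ ≤_) a → All (0ℤ ≤_) b →
    Realisable a b →
    Realisable (nextDegrees a b) (nextDimensions b)
-- Matching on `dims zero` replaces `b₁` by `+ ∣ e ∣`, so `nextEdge` becomes `F` below.
theorem2 n m _ a (b₁ ∷ b) a↘ _ _ _ (e ∷ G , degrees , dims) with refl ← dims zero =
  realisable-sort (reduceOn F a) b
    (G′ ,
     (λ v → lookup-reduceOn F a v (begin
       + (incidence F v + degree G′ v)  ≡⟨ cong +_ (degree-∷ F G′ v) ⟨
       + degree (F ∷ G′) v              ≡⟨ cong +_ (degrees′ v) ⟩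
       + degree (e ∷ G) v               ≡⟨ degrees v ⟩
       lookup a v                       ∎)) ,
     λ k → trans (cong +_ (dims′ k)) (dims (suc k)))
  where
  open ≡-Reasoning
  F = firstPositions n (+ ∣ e ∣)

  F-largest : ∀ {i j} → i ∈ F → j ∉ F → degree (e ∷ G) j ℕ.≤ degree (e ∷ G) i
  -- The bound `∣ e ∣` separates the positions: `i` is below it and `j` is not, so `i` comes first.
  F-largest {i} {j} i∈F j∉F = ℤ.drop‿+≤+ (subst₂ _≤_ (sym (degrees j)) (sym (degrees i))
    (NonIncreasing⇒lookup-mono a↘ (ℤ.drop‿+<+
      (ℤ.<-≤-trans (∈firstPositions⇒< {k = + ∣ e ∣} i∈F) (ℤ.≮⇒≥ (j∉F ∘ <⇒∈firstPositions))))))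

  -- An edge has at most `n` vertices, so `F` is not cut off and has exactly `∣ e ∣` elements.
  realigned = realign F {e} {G} (sym (∣firstPositions∣ (∣p∣≤n e))) F-largest (<-wellFounded _)
  G′       = proj₁ realigned
  degrees′ = proj₁ (proj₂ realigned)
  dims′    = proj₂ (proj₂ realigned)
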